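{- Let $\mathbb{X}=(X,\tau_{\mathbb{X}})$ be a $T_0$ topological space and $\Omega_0$ a viable base of $\mathbb{X}$. Then the spectral compactification $\widehat{\mathbb{X}}_{\Omega_0}$ is a core-compact space, and the map $\iota:X\to\widehat{X}$, $\iota(x)=\{I\in\mathrm{Idl}(\Omega_0): x\in\bigcup I\}$, is a dense topological embedding (continuous, injective, relatively open, with dense image). That is, $\widehat{\mathbb{X}}_{\Omega_0}$ is a core-compactification of $\mathbb{X}$.
   Context: A viable base of $\mathbb{X}$ is a family $\Omega_0\subseteq\tau_{\mathbb{X}}$ closed under finite unions and finite intersections (so $\emptyset,X\in\Omega_0$) which is a base of $\tau_{\mathbb{X}}$. $\mathrm{Idl}(\Omega_0)$ is the set of ideals (nonempty, downward closed, directed subsets) of $(\Omega_0,\subseteq)$, ordered by inclusion; it is a complete lattice. A completely prime filter of a complete lattice $L$ is a nonempty upward closed $F\subseteq L$ closed under binary meets such that whenever $\bigvee A\in F$ for $A\subseteq L$ then $A\cap F\neq\emptyset$. $\widehat{\mathbb{X}}_{\Omega_0}$ is the set $\widehat{X}$ of completely prime filters of $\mathrm{Idl}(\Omega_0)$ with the (hull-kernel) topology whose open sets are exactly $\mathcal{O}_I=\{y\in\widehat{X}: I\in y\}$, $I\in\mathrm{Idl}(\Omega_0)$. A space is core-compact if its lattice of open sets under inclusion is a continuous lattice. A core-compactification of $\mathbb{X}$ is a core-compact space into which $\mathbb{X}$ embeds as a dense subspace. -}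

module Defs where

open import Axiom.ExcludedMiddle using (ExcludedMiddle)
open import Data.Product using (Σ; ∃; _×_; _,_; proj₁; proj₂)
open import Data.Sum using (_⊎_; inj₁; inj₂)
open import Function using (_∘_; Func; Injective)
open import Level using (Level; Lift; lift; lower; suc; _⊔_)
open import Relation.Binary using (Poset; Setoid; _Respects_)
import Relation.Binary.Construct.On as On
open import Relation.Nullary using (¬_; yes; no; contradiction)
open import Relation.Nullary.Decidable using (True; toWitness; fromWitness)
open import Relation.Unary
  using (Pred; _∈_; _∉_; _⊆_; _≐_; _∩_; _∪_; _≬_; _⊢_; ⋃; Satisfiable)
open import Relation.Unary.Polymorphic using (∅) renaming (U to 𝕌)
open import Relation.Unary.Relation.Binary.Equality using (≐-setoid)
open import Relation.Unary.Relation.Binary.Subset using (⊆-poset)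

private
  variable
    a b c ℓ ℓ₁ ℓ₂ o p t c′ ℓ′ t′ : Level

-- Subsets of A : Set a are predicates valued in Set a.  Given excluded
-- middle every predicate on A is pointwise equivalent to one valued in Set a
-- (see resize below), so quantifying over 𝒫 A is quantifying over all subsets
-- of A.  Operations that raise the level are stated up to _≐_.
𝒫 : Set a → Set (suc a)
𝒫 {a} A = Pred A a

⋃₀ : {A : Set a} → Pred (𝒫 A) p → Pred A (suc a ⊔ p)
⋃₀ 𝒜 = ⋃ (∃ 𝒜) proj₁

⟨_,⊆⟩ : {A : Set a} → Pred (𝒫 A) p → Poset (suc a ⊔ p) a a
⟨_,⊆⟩ {a} {A = A} 𝒮 = On.poset (⊆-poset A a) (proj₁ {B = 𝒮})

module _ (P : Poset c ℓ₁ ℓ₂) where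
  open Poset P

  record IsJoin (A : Pred Carrier p) (s : Carrier) : Set (c ⊔ ℓ₂ ⊔ p) where
    field
      upper : ∀ {x} → x ∈ A → x ≤ s
      least : ∀ {u} → (∀ {x} → x ∈ A → x ≤ u) → s ≤ u

  record IsMeet (x y m : Carrier) : Set (c ⊔ ℓ₂) where
    field
      lowerˡ   : m ≤ x
      lowerʳ   : m ≤ y
      greatest : ∀ {l} → l ≤ x → l ≤ y → l ≤ m

  record IsDirected (D : Pred Carrier p) : Set (c ⊔ ℓ₂ ⊔ p) where
    field
      nonempty : Satisfiable D
      directed : ∀ {x y} → x ∈ D → y ∈ D → ∃ λ z → z ∈ D × x ≤ z × y ≤ z

  _≪_ : Carrier → Carrier → Set (suc c ⊔ ℓ₂)
  x ≪ y = ∀ {D : 𝒫 Carrier} → IsDirected D → ∀ {s} → IsJoin D s → y ≤ s →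
          ∃ λ d → d ∈ D × x ≤ d

  record IsContinuousLattice : Set (suc c ⊔ ℓ₂) where
    field
      complete      : (A : 𝒫 Carrier) → ∃ (IsJoin A)
      approximation : ∀ x → IsJoin (λ y → y ≪ x) x

  record IsIdeal (I : Pred Carrier p) : Set (c ⊔ ℓ₂ ⊔ p) where
    field
      downward   : ∀ {x y} → x ≤ y → y ∈ I → x ∈ I
      isDirected : IsDirected I
    open IsDirected isDirected public

  -- Joins and meets are given by their universal property; in a complete
  -- lattice they always exist.
  record IsCompletelyPrimeFilter (F : Pred Carrier p) :
         Set (suc c ⊔ ℓ₂ ⊔ p) where
    field
      nonempty : Satisfiable F
      upward   : ∀ {x y} → x ≤ y → x ∈ F → y ∈ F
      meet     : ∀ {x y m} → IsMeet x y m → x ∈ F → y ∈ F → m ∈ F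
      prime    : ∀ {A : 𝒫 Carrier} {s} → IsJoin A s → s ∈ F → A ≬ F

  Ideal : Set (suc c ⊔ ℓ₂)
  Ideal = Σ (𝒫 Carrier) IsIdeal

  CompletelyPrimeFilter : Set (suc c ⊔ ℓ₂)
  CompletelyPrimeFilter = Σ (𝒫 Carrier) IsCompletelyPrimeFilter

Idl : (P : Poset c ℓ₁ ℓ₂) → Poset (suc c ⊔ ℓ₂) c c
Idl P = ⟨ IsIdeal P ,⊆⟩

record Space c ℓ t : Set (suc (suc c ⊔ ℓ ⊔ t)) where
  field
    points : Setoid c ℓ
  open Setoid points public
  field
    Open        : Pred (𝒫 Carrier) t
    Open-resp-≐ : Open Respects _≐_
    Open-resp-≈ : ∀ {V} → Open V → V Respects _≈_
    𝕌-open      : Open 𝕌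
    ∩-open      : ∀ {V W} → Open V → Open W → Open (V ∩ W)
    ⋃-open      : {𝒜 : 𝒫 (𝒫 Carrier)} → 𝒜 ⊆ Open →
                  ∃ λ V → Open V × V ≐ ⋃₀ 𝒜

CoreCompact : Space c ℓ t → Set (suc (suc c ⊔ t))
CoreCompact 𝕏 = IsContinuousLattice ⟨ Space.Open 𝕏 ,⊆⟩

T₀ : Space c ℓ t → Set (suc c ⊔ ℓ ⊔ t)
T₀ 𝕏 = ∀ {x y} → ¬ (x ≈ y) →
       ∃ λ V → Open V × ((x ∈ V × y ∉ V) ⊎ (x ∉ V × y ∈ V))
  where open Space 𝕏

module _ (𝕏 : Space c ℓ t) (𝕐 : Space c′ ℓ′ t′)
         (f : Func (Space.points 𝕏) (Space.points 𝕐)) where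
  private
    module 𝕏 = Space 𝕏
    module 𝕐 = Space 𝕐
  open Func f using (to)

  image : Pred 𝕏.Carrier p → Pred 𝕐.Carrier (c ⊔ ℓ′ ⊔ p)
  image V y = ∃ λ x → x ∈ V × to x 𝕐.≈ y

  range : Pred 𝕐.Carrier (c ⊔ ℓ′)
  range y = ∃ λ x → to x 𝕐.≈ y

  record IsEmbedding : Set (suc (c ⊔ c′) ⊔ ℓ ⊔ ℓ′ ⊔ t ⊔ t′) where
    field
      continuous      : ∀ {W} → 𝕐.Open W → ∃ λ V → 𝕏.Open V × V ≐ (to ⊢ W)
      injective       : Injective 𝕏._≈_ 𝕐._≈_ to
      relatively-open : ∀ {V} → 𝕏.Open V →
                        ∃ λ W → 𝕐.Open W × image V ≐ W ∩ range

  Dense : Set (suc c′ ⊔ c ⊔ ℓ′ ⊔ t′)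
  Dense = ∀ {W} → 𝕐.Open W → Satisfiable W → W ≬ range

  record IsCoreCompactification :
         Set (suc (c ⊔ suc c′ ⊔ t′) ⊔ ℓ ⊔ ℓ′ ⊔ t) where
    field
      core-compact : CoreCompact 𝕐
      embedding    : IsEmbedding
      dense        : Dense

record IsViableBase (𝕏 : Space c ℓ t) (Ω₀ : Pred (𝒫 (Space.Carrier 𝕏)) o) :
       Set (suc (suc c) ⊔ t ⊔ o) where
  open Space 𝕏
  field
    resp-≐  : Ω₀ Respects _≐_
    ∅-mem   : ∅ ∈ Ω₀
    𝕌-mem   : 𝕌 ∈ Ω₀
    ∪-mem   : ∀ {V W} → V ∈ Ω₀ → W ∈ Ω₀ → (V ∪ W) ∈ Ω₀
    ∩-mem   : ∀ {V W} → V ∈ Ω₀ → W ∈ Ω₀ → (V ∩ W) ∈ Ω₀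
    ⊆Open   : Ω₀ ⊆ Open
    isBase  : ∀ {V} → Open V → ∃ λ (ℬ : 𝒫 (𝒫 Carrier)) → ℬ ⊆ Ω₀ × V ≐ ⋃₀ ℬ

-- The ambient set theory enters as ExcludedMiddle.  Joins of ideals and unions
-- of opens quantify over large types, and resize brings them back to 𝒫.
-- ExcludedMiddle decides types rather than truncated propositions, so together
-- with function extensionality it also yields the axiom of choice.
module _ (em : ∀ {ℓ} → ExcludedMiddle ℓ) where

  resize : {A : Set a} → Pred A p → 𝒫 A
  resize {a} P x = Lift a (True (em {P = P x}))

  resize-≐ : {A : Set a} (P : Pred A p) → resize P ≐ P
  resize-≐ P = (λ q → toWitness (lower q)) , (λ q → lift (fromWitness q))

  module Spectral (𝕏 : Space c ℓ t) (Ω₀ : Pred (𝒫 (Space.Carrier 𝕏)) o)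
                  (viable : IsViableBase 𝕏 Ω₀) where
    open Space 𝕏
    open IsViableBase viable

    Ω : Poset (suc c ⊔ o) c c
    Ω = ⟨ Ω₀ ,⊆⟩
    private module Ω = Poset Ω

    L : Poset (suc (suc c ⊔ o)) (suc c ⊔ o) (suc c ⊔ o)
    L = Idl Ω

    private module L = Poset L

    ideal : (I : 𝒫 Ω.Carrier) →
            (∀ {v w} → v Ω.≤ w → w ∈ I → v ∈ I) →
            (∅ , ∅-mem) ∈ I →
            (∀ {V W} (v : V ∈ Ω₀) (w : W ∈ Ω₀) → (V , v) ∈ I → (W , w) ∈ I →
               (V ∪ W , ∪-mem v w) ∈ I) →
            Ideal Ω
    ideal I down bot join = I , record
      { downward   = λ {v} {w} → down {v} {w}
      ; isDirected = record
        { nonempty = _ , bot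
        ; directed = λ { {_ , v} {_ , w} p q →
            _ , join v w p q , inj₁ , inj₂ }
        }
      }

    ∅∈ : (I : Ideal Ω) → (∅ , ∅-mem) ∈ proj₁ I
    ∅∈ (I , isI) = downward {y = proj₁ nonempty} (λ ()) (proj₂ nonempty)
      where open IsIdeal isI

    ∪∈ : (I : Ideal Ω) → ∀ {V W} (v : V ∈ Ω₀) (w : W ∈ Ω₀) →
         (V , v) ∈ proj₁ I → (W , w) ∈ proj₁ I →
         (V ∪ W , ∪-mem v w) ∈ proj₁ I
    ∪∈ (I , isI) v w p q with IsIdeal.directed isI p q
    ... | z , z∈I , V⊆z , W⊆z =
      IsIdeal.downward isI {y = z}
        (λ { (inj₁ i) → V⊆z i ; (inj₂ j) → W⊆z j }) z∈I

    ↓ : Ω.Carrier → Ideal Ω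
    ↓ u = ideal (λ v → Lift _ (v Ω.≤ u))
      (λ v≤w w≤u → lift (λ i → lower w≤u (v≤w i)))
      (lift (λ ()))
      (λ _ _ p q → lift (λ { (inj₁ i) → lower p i ; (inj₂ j) → lower q j }))

    ↓-least : ∀ {u} (I : Ideal Ω) → u ∈ proj₁ I → ↓ u L.≤ I
    ↓-least {u} (I , isI) u∈I v≤u = IsIdeal.downward isI {y = u} (lower v≤u) u∈I

    ⊤ᴵ : Ideal Ω
    ⊤ᴵ = ideal 𝕌 (λ _ _ → _) _ (λ _ _ _ _ → _)

    _∧ᴵ_ : Ideal Ω → Ideal Ω → Ideal Ω
    I ∧ᴵ J = ideal (proj₁ I ∩ proj₁ J)
      (λ {v} {w} v≤w (p , q) → IsIdeal.downward (proj₂ I) {y = w} v≤w p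
                             , IsIdeal.downward (proj₂ J) {y = w} v≤w q)
      (∅∈ I , ∅∈ J)
      (λ v w (p , q) (p′ , q′) → ∪∈ I v w p p′ , ∪∈ J v w q q′)

    ∧ᴵ-isMeet : ∀ I J → IsMeet L I J (I ∧ᴵ J)
    ∧ᴵ-isMeet I J = record
      { lowerˡ = proj₁ ; lowerʳ = proj₂ ; greatest = λ f g p → f p , g p }

    -- The intersection of all ideals containing every member of 𝒜.
    module _ (𝒜 : Pred (Ideal Ω) p) where
      Bound : Pred (Ideal Ω) (suc (suc c ⊔ o) ⊔ p)
      Bound J = ∀ {I} → I ∈ 𝒜 → I L.≤ J

      InAll : Pred Ω.Carrier (suc (suc c ⊔ o) ⊔ p)
      InAll v = ∀ J → Bound J → v ∈ proj₁ J

      fromAll : resize InAll ⊆ InAll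
      fromAll = proj₁ (resize-≐ InAll)

      toAll : InAll ⊆ resize InAll
      toAll = proj₂ (resize-≐ InAll)

      ⋁ : Ideal Ω
      ⋁ = ideal (resize InAll)
        (λ {v} {w} v≤w p → toAll λ J b →
           IsIdeal.downward (proj₂ J) {y = w} v≤w (fromAll p J b))
        (toAll λ J _ → ∅∈ J)
        (λ v w p q → toAll λ J b → ∪∈ J v w (fromAll p J b) (fromAll q J b))

      ⋁-isJoin : IsJoin L 𝒜 ⋁
      ⋁-isJoin = record
        { upper = λ I∈𝒜 v∈I → toAll λ J b → b I∈𝒜 v∈I
        ; least = λ {J} b p → fromAll p J b
        }

    -- The hull-kernel open determined by an ideal.
    𝒪 : Ideal Ω → Pred (CompletelyPrimeFilter L) (suc (suc c ⊔ o))
    𝒪 I y = I ∈ proj₁ y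

    X̂ : Space (suc (suc (suc c ⊔ o))) (suc (suc c ⊔ o)) (suc (suc (suc c ⊔ o)))
    X̂ = record
      { points      = On.setoid (≐-setoid L.Carrier (suc (suc c ⊔ o)))
                        (proj₁ {B = IsCompletelyPrimeFilter L})
      ; Open        = λ V → ∃ λ I → V ≐ 𝒪 I
      ; Open-resp-≐ = λ (V⊆W , W⊆V) (I , V⊆I , I⊆V) →
          I , (λ y∈W → V⊆I (W⊆V y∈W)) , (λ y∈I → V⊆W (I⊆V y∈I))
      ; Open-resp-≈ = λ (I , V⊆I , I⊆V) x≈y x∈V → I⊆V (proj₁ x≈y (V⊆I x∈V))
      ; 𝕌-open      = ⊤ᴵ , (λ {y} _ → ⊤ᴵ∈ y) , _
      ; ∩-open      = λ (I , V⊆I , I⊆V) (J , W⊆J , J⊆W) →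
          I ∧ᴵ J ,
          (λ {y} (y∈V , y∈W) → IsCompletelyPrimeFilter.meet (proj₂ y)
             (∧ᴵ-isMeet I J) (V⊆I y∈V) (W⊆J y∈W)) ,
          (λ {y} m → I⊆V (IsCompletelyPrimeFilter.upward (proj₂ y)
                            {x = I ∧ᴵ J} {y = I} proj₁ m)
                   , J⊆W (IsCompletelyPrimeFilter.upward (proj₂ y)
                            {x = I ∧ᴵ J} {y = J} proj₂ m))
      ; ⋃-open      = union
      }
      where
      ⊤ᴵ∈ : (y : CompletelyPrimeFilter L) → ⊤ᴵ ∈ proj₁ y
      ⊤ᴵ∈ (F , isF) = upward {x = proj₁ nonempty} {y = ⊤ᴵ} _ (proj₂ nonempty)
        where open IsCompletelyPrimeFilter isF

      union : {𝒜 : 𝒫 (𝒫 (CompletelyPrimeFilter L))} →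
              𝒜 ⊆ (λ V → ∃ λ I → V ≐ 𝒪 I) →
              ∃ λ V → (∃ λ I → V ≐ 𝒪 I) × V ≐ ⋃₀ 𝒜
      union {𝒜} 𝒜-open =
        (λ y → Lift _ (𝒪 J y)) , (J , lower , lift) , sub , sup
        where
        Below : Pred (Ideal Ω) (suc (suc (suc (suc c ⊔ o))))
        Below I = ∃ λ V → V ∈ 𝒜 × V ≐ 𝒪 I

        J : Ideal Ω
        J = ⋁ (resize Below)

        sub : (λ y → Lift _ (𝒪 J y)) ⊆ ⋃₀ 𝒜
        sub {y} J∈y with IsCompletelyPrimeFilter.prime (proj₂ y)
                           (⋁-isJoin (resize Below)) (lower J∈y)
        ... | I , below , I∈y with proj₁ (resize-≐ Below) below
        ...   | V , V∈𝒜 , _ , I⊆V = (V , V∈𝒜) , I⊆V I∈y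

        sup : ⋃₀ 𝒜 ⊆ (λ y → Lift _ (𝒪 J y))
        sup {y} ((V , V∈𝒜) , y∈V) with 𝒜-open V∈𝒜
        ... | I , V⊆I , I⊆V = lift
          (IsCompletelyPrimeFilter.upward (proj₂ y) {x = I} {y = J}
            (IsJoin.upper (⋁-isJoin (resize Below)) {x = I}
              (proj₂ (resize-≐ Below) (V , V∈𝒜 , V⊆I , I⊆V)))
            (V⊆I y∈V))

    ⋃ᴵ : Ideal Ω → Pred Carrier (suc c ⊔ o)
    ⋃ᴵ I = ⋃ (∃ (proj₁ I)) (proj₁ ∘ proj₁)

    ι₀ : Carrier → 𝒫 (Ideal Ω)
    ι₀ x I = Lift _ (x ∈ ⋃ᴵ I)

    ι₀-isCompletelyPrimeFilter : ∀ x → IsCompletelyPrimeFilter L (ι₀ x)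
    ι₀-isCompletelyPrimeFilter x = record
      { nonempty = ⊤ᴵ , lift (((𝕌 , 𝕌-mem) , _) , _)
      ; upward   = λ { I≤J (lift ((u , u∈I) , x∈u)) → lift ((u , I≤J u∈I) , x∈u) }
      ; meet     = meet
      ; prime    = prime
      }
      where
      meet : ∀ {I J M} → IsMeet L I J M → I ∈ ι₀ x → J ∈ ι₀ x → M ∈ ι₀ x
      meet {I} {J} isMeet (lift ((u , u∈I) , x∈u)) (lift ((v , v∈J) , x∈v)) =
        lift ((w , greatest {↓ w} w≤I w≤J (lift (λ i → i))) , x∈u , x∈v)
        where
        open IsMeet isMeet
        w : Ω.Carrier
        w = proj₁ u ∩ proj₁ v , ∩-mem (proj₂ u) (proj₂ v)
        w≤I : ↓ w L.≤ I
        w≤I = ↓-least {w} I (IsIdeal.downward (proj₂ I) {x = w} {y = u} proj₁ u∈I)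
        w≤J : ↓ w L.≤ J
        w≤J = ↓-least {w} J (IsIdeal.downward (proj₂ J) {x = w} {y = v} proj₂ v∈J)

      prime : ∀ {𝒜 : 𝒫 (Ideal Ω)} {J} → IsJoin L 𝒜 J → J ∈ ι₀ x → 𝒜 ≬ ι₀ x
      prime {𝒜} isJoin (lift ((u , u∈J) , x∈u)) with em {P = 𝒜 ≬ ι₀ x}
      ... | yes meets = meets
      ... | no misses = contradiction x∈u (lower (IsJoin.least isJoin {K} bound u∈J))
        where
        K : Ideal Ω
        K = ideal (λ v → Lift _ (x ∉ proj₁ v))
          (λ v≤w x∉w → lift (λ x∈v → lower x∉w (v≤w x∈v)))
          (lift (λ ()))
          (λ _ _ p q → lift (λ { (inj₁ i) → lower p i ; (inj₂ j) → lower q j }))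
        bound : ∀ {I} → I ∈ 𝒜 → I L.≤ K
        bound {I} I∈𝒜 {v} v∈I =
          lift (λ x∈v → misses (I , I∈𝒜 , lift ((v , v∈I) , x∈v)))

    ι : Func points (Space.points X̂)
    ι = record
      { to   = λ x → ι₀ x , ι₀-isCompletelyPrimeFilter x
      ; cong = λ x≈y → (λ {I} → transport x≈y {I}) , (λ {I} → transport (sym x≈y) {I})
      }
      where
      transport : ∀ {x y} → x ≈ y → ι₀ x ⊆ ι₀ y
      transport x≈y (lift ((u , u∈I) , x∈u)) =
        lift ((u , u∈I) , Open-resp-≈ (⊆Open (proj₂ u)) x≈y x∈u)

{-# OPTIONS --safe #-}
-- Idl(Ω₀) is an algebraic lattice: every ideal I is the directed join of the
-- principal ideals ↓ v with v ∈ I.  Zorn's lemma yields, for v ∉ J, a prime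
-- filter of Ω₀ containing v and missing J; the ideals meeting it form a point
-- of X̂.  Hence I ↦ 𝒪 I reflects the order, each 𝒪 (↓ v) is compact, and X̂ is
-- core-compact.  For density, an ideal all of whose members are empty is the
-- empty join, which no completely prime filter contains.
module Submission where

open import Axiom.ExcludedMiddle using (ExcludedMiddle)
open import Axiom.Extensionality.Propositional using (Extensionality)
open import Data.Bool.Base using (Bool; true; false; T)
open import Data.Empty using (⊥-elim)
open import Data.Product using (∃; _×_; _,_; proj₁; proj₂)
open import Data.Sum using (_⊎_; inj₁; inj₂)
open import Function using (_∘_; id; case_of_; Func; Injective)
open import Level using (Level; Lift; lift; lower; suc; _⊔_)
open import Relation.Binary using (Poset)
open import Relation.Binary.Lattice.Bundles using (DistributiveLattice)
import Relation.Binary.Lattice.Properties.JoinSemilattice as JoinProperties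
import Relation.Binary.Lattice.Properties.MeetSemilattice as MeetProperties
open import Relation.Binary.PropositionalEquality using (_≡_; refl; subst)
open import Relation.Nullary using (¬_; yes; no; contradiction)
open import Relation.Nullary.Decidable using (⌊_⌋; toWitness; fromWitness)
open import Relation.Unary
  using (Pred; _∈_; _∉_; _⊆_; _≐_; _∩_; _∪_; _≬_; _⊢_; ⋃; Satisfiable)
open import Relation.Unary.Polymorphic using (∅)
open import Defs

private
  variable
    a c ℓ ℓ₁ ℓ₂ o p t : Level

-- Zorn's lemma for families of subsets.

T-injective : ∀ {b b′} → (T b → T b′) → (T b′ → T b) → b ≡ b′
T-injective {false} {false} _ _ = refl
T-injective {false} {true}  _ g = ⊥-elim (g _)
T-injective {true}  {false} f _ = ⊥-elim (f _)
T-injective {true}  {true}  _ _ = refl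

-- Subsets are Bool-valued here, so that mutual inclusion gives _≡_ and the
-- choice made in next depends only on the extension of the subset.
module Subsets (em : ∀ {ℓ} → ExcludedMiddle ℓ)
               (ext : ∀ {a b} → Extensionality a b) (A : Set a) where

  Subset : Set a
  Subset = A → Bool

  ⟦_⟧ : Subset → Pred A _
  ⟦ S ⟧ x = T (S x)

  infix 4 _⊑_
  _⊑_ : Subset → Subset → Set a
  S ⊑ N = ⟦ S ⟧ ⊆ ⟦ N ⟧

  ⊑-antisym : ∀ {S N} → S ⊑ N → N ⊑ S → S ≡ N
  ⊑-antisym S⊑N N⊑S = ext λ x → T-injective (S⊑N {x}) (N⊑S {x})

  ⟪_⟫ : Pred A p → Subset
  ⟪ P ⟫ x = ⌊ em {P = P x} ⌋

  ⟪⟫⁻ : (P : Pred A p) → ⟦ ⟪ P ⟫ ⟧ ⊆ P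
  ⟪⟫⁻ P = toWitness

  ⟪⟫⁺ : (P : Pred A p) → P ⊆ ⟦ ⟪ P ⟫ ⟧
  ⟪⟫⁺ P = fromWitness

  ⋃ˢ : 𝒫 Subset → Subset
  ⋃ˢ 𝒞 = ⟪ ⋃ (∃ 𝒞) (⟦_⟧ ∘ proj₁) ⟫

  ⋃ˢ⁻ : (𝒞 : 𝒫 Subset) → ∀ {x} → x ∈ ⟦ ⋃ˢ 𝒞 ⟧ → ∃ λ S → S ∈ 𝒞 × x ∈ ⟦ S ⟧
  ⋃ˢ⁻ 𝒞 x∈ with ⟪⟫⁻ (⋃ (∃ 𝒞) (⟦_⟧ ∘ proj₁)) x∈
  ... | (S , S∈𝒞) , x∈S = S , S∈𝒞 , x∈S

  ⋃ˢ-upper : (𝒞 : 𝒫 Subset) → ∀ {S} → S ∈ 𝒞 → S ⊑ ⋃ˢ 𝒞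
  ⋃ˢ-upper 𝒞 S∈𝒞 x∈S = ⟪⟫⁺ (⋃ (∃ 𝒞) (⟦_⟧ ∘ proj₁)) ((_ , S∈𝒞) , x∈S)

  ⋃ˢ-least : (𝒞 : 𝒫 Subset) → ∀ {N} → (∀ {S} → S ∈ 𝒞 → S ⊑ N) → ⋃ˢ 𝒞 ⊑ N
  ⋃ˢ-least 𝒞 bound x∈ with ⋃ˢ⁻ 𝒞 x∈
  ... | S , S∈𝒞 , x∈S = bound S∈𝒞 x∈S

  IsChain : Pred Subset p → Set _
  IsChain 𝒞 = ∀ {S N} → S ∈ 𝒞 → N ∈ 𝒞 → S ⊑ N ⊎ N ⊑ S

  module Zorn (P : Pred Subset p)
              (chain-closed : (𝒞 : 𝒫 Subset) → Satisfiable 𝒞 → IsChain 𝒞 →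
                              𝒞 ⊆ P → ⋃ˢ 𝒞 ∈ P)
              {S₀ : Subset} (S₀∈P : S₀ ∈ P) where

    Enlargement : Subset → Pred Subset _
    Enlargement S N = N ∈ P × S ⊑ N × ¬ (N ⊑ S)

    -- `em` decides the untruncated existential, so a positive answer carries a witness. This is the
    -- choice function of the argument.
    next : Subset → Subset
    next S with em {P = ∃ (Enlargement S)}
    ... | yes (N , _) = N
    ... | no  _       = S

    next-extensive : ∀ S → S ⊑ next S
    next-extensive S with em {P = ∃ (Enlargement S)}
    ... | yes (_ , _ , S⊑N , _) = S⊑N
    ... | no  _                 = id

    next-P : ∀ {S} → S ∈ P → next S ∈ P
    next-P {S} S∈P with em {P = ∃ (Enlargement S)}
    ... | yes (_ , N∈P , _) = N∈P
    ... | no  _             = S∈P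

    next-fixed⇒maximal : ∀ {S} → next S ⊑ S → ∀ {N} → N ∈ P → S ⊑ N → N ⊑ S
    next-fixed⇒maximal {S} fixed {N} N∈P S⊑N with em {P = ∃ (Enlargement S)}
    ... | yes (_ , _ , _ , larger) = ⊥-elim (larger fixed)
    ... | no  none with em {P = N ⊑ S}
    ...   | yes N⊑S = N⊑S
    ...   | no  N⋢S = ⊥-elim (none (N , N∈P , S⊑N , N⋢S))

    -- An inductive family takes the place of transfinite iteration of `next` from `S₀`. Unions are
    -- formed over arbitrary inhabited subfamilies; that these are chains is established only
    -- afterwards, in `tower-isChain`.
    data Tower : Pred Subset (suc a) where
      base : Tower S₀
      step : ∀ {S} → Tower S → Tower (next S)
      sup  : (𝒞 : 𝒫 Subset) → Satisfiable 𝒞 → 𝒞 ⊆ Tower → Tower (⋃ˢ 𝒞)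

    base-least : ∀ {S} → Tower S → S₀ ⊑ S
    base-least base                       = id
    base-least (step {S} τ)               = next-extensive S ∘ base-least τ
    base-least (sup 𝒞 (_ , S∈𝒞) 𝒞⊆Tower) =
      ⋃ˢ-upper 𝒞 S∈𝒞 ∘ base-least (𝒞⊆Tower S∈𝒞)

    -- No tower stage strictly below `C` can jump past `C` in one application of `next`.
    Extreme : Pred Subset (suc a)
    Extreme C = ∀ {S} → Tower S → S ⊑ C → ¬ (C ⊑ S) → next S ⊑ C

    -- Induction on the tower derivation of `S`, with `C` fixed. Extremeness of `C` handles a
    -- successor of a stage strictly below `C`.
    compare : ∀ {C S} → Tower C → Extreme C → Tower S → S ⊑ C ⊎ next C ⊑ S
    compare γ extreme base = inj₁ (base-least γ)
    compare {C} γ extreme (step {S} σ) with compare γ extreme σ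
    ... | inj₂ next⊑S = inj₂ (next-extensive S ∘ next⊑S)
    ... | inj₁ S⊑C with em {P = C ⊑ S}
    -- The two sets include each other, hence are equal, so `next` makes the same choice on both.
    ...   | yes C⊑S = inj₂ (subst (λ N → next C ⊑ next N) (⊑-antisym C⊑S S⊑C) id)
    ...   | no  C⋢S = inj₁ (extreme σ S⊑C C⋢S)
    compare {C} γ extreme (sup 𝒞 _ 𝒞⊆Tower)
      with em {P = ∃ λ S → S ∈ 𝒞 × next C ⊑ S}
    ... | yes (S , S∈𝒞 , next⊑S) = inj₂ (⋃ˢ-upper 𝒞 S∈𝒞 ∘ next⊑S)
    ... | no  none = inj₁ (⋃ˢ-least 𝒞 bound)
      where
      bound : ∀ {S} → S ∈ 𝒞 → S ⊑ C
      bound {S} S∈𝒞 with compare γ extreme (𝒞⊆Tower S∈𝒞)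
      ... | inj₁ S⊑C    = S⊑C
      ... | inj₂ next⊑S = ⊥-elim (none (S , S∈𝒞 , next⊑S))

    -- Induction on the derivation of `C`. If a union is not inside `S`, some member of the family
    -- is not inside `S` either, and that member is extreme by induction, so comparing it with `S`
    -- decides the case.
    extreme : ∀ {C} → Tower C → Extreme C
    extreme base σ _ C⋢S = ⊥-elim (C⋢S (base-least σ))
    extreme (step {C} γ) {S} σ _ next⋢S with compare γ (extreme γ) σ
    ... | inj₂ next⊑S = ⊥-elim (next⋢S next⊑S)
    ... | inj₁ S⊑C with em {P = C ⊑ S}
    ...   | yes C⊑S = subst (λ N → next N ⊑ next C) (⊑-antisym C⊑S S⊑C) id
    ...   | no  C⋢S = next-extensive C ∘ extreme γ σ S⊑C C⋢S
    extreme (sup 𝒞 _ 𝒞⊆Tower) {S} σ _ ⋃⋢S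
      with em {P = ∃ λ C → C ∈ 𝒞 × ¬ (C ⊑ S)}
    ... | no none = ⊥-elim (⋃⋢S (⋃ˢ-least 𝒞 bound))
      where
      bound : ∀ {C} → C ∈ 𝒞 → C ⊑ S
      bound {C} C∈𝒞 with em {P = C ⊑ S}
      ... | yes C⊑S = C⊑S
      ... | no  C⋢S = ⊥-elim (none (C , C∈𝒞 , C⋢S))
    ... | yes (C , C∈𝒞 , C⋢S)
      with compare (𝒞⊆Tower C∈𝒞) (extreme (𝒞⊆Tower C∈𝒞)) σ
    ...   | inj₂ next⊑S = ⊥-elim (C⋢S (next⊑S ∘ next-extensive C))
    ...   | inj₁ S⊑C    = ⋃ˢ-upper 𝒞 C∈𝒞 ∘ extreme (𝒞⊆Tower C∈𝒞) σ S⊑C C⋢S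

    tower-isChain : IsChain Tower
    tower-isChain {S} {N} σ ν with compare ν (extreme ν) σ
    ... | inj₁ S⊑N    = inj₁ S⊑N
    ... | inj₂ next⊑S = inj₂ (next⊑S ∘ next-extensive N)

    tower⊆P : Tower ⊆ P
    tower⊆P base                        = S₀∈P
    tower⊆P (step σ)                    = next-P (tower⊆P σ)
    tower⊆P (sup 𝒞 nonempty 𝒞⊆Tower) = chain-closed 𝒞 nonempty
      (λ S∈𝒞 N∈𝒞 → tower-isChain (𝒞⊆Tower S∈𝒞) (𝒞⊆Tower N∈𝒞))
      (λ S∈𝒞 → tower⊆P (𝒞⊆Tower S∈𝒞))

    -- The union of the whole tower is again a stage, and so is its `next`, which therefore lies
    -- inside the union. A stage that `next` does not enlarge is maximal. `resize` is needed because
    -- `Tower` lives one universe above the families that `sup` accepts.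
    zorn : ∃ λ M → M ∈ P × (∀ {N} → N ∈ P → M ⊑ N → N ⊑ M)
    zorn = ⋃ˢ (resize em Tower) , tower⊆P top ,
           next-fixed⇒maximal (⋃ˢ-upper (resize em Tower) (toSmall (step top)))
      where
      toSmall : Tower ⊆ resize em Tower
      toSmall = proj₂ (resize-≐ em Tower)
      top : Tower (⋃ˢ (resize em Tower))
      top = sup _ (_ , toSmall base) (proj₁ (resize-≐ em Tower))

-- The prime filter theorem for distributive lattices.

module PrimeFilterTheorem (em : ∀ {ℓ} → ExcludedMiddle ℓ)
                          (ext : ∀ {a b} → Extensionality a b)
                          (D : DistributiveLattice c ℓ₁ ℓ₂) where
  open DistributiveLattice D renaming (refl to ≤-refl; trans to ≤-trans)
  open MeetProperties meetSemilattice using (∧-monotonic)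
  open JoinProperties joinSemilattice using (∨-monotonic)
  open Subsets em ext Carrier

  record IsFilter (F : Pred Carrier p) : Set (c ⊔ ℓ₂ ⊔ p) where
    field
      upward : ∀ {x y} → x ≤ y → x ∈ F → y ∈ F
      meet   : ∀ {x y} → x ∈ F → y ∈ F → (x ∧ y) ∈ F

  IsPrime : Pred Carrier p → Set _
  IsPrime F = ∀ {x y} → (x ∨ y) ∈ F → x ∈ F ⊎ y ∈ F

  module _ {J : Pred Carrier p} (isIdeal : IsIdeal poset J) {v} (v∉J : v ∉ J)
           where
    open IsIdeal isIdeal

    ∨-closed : ∀ {x y} → x ∈ J → y ∈ J → (x ∨ y) ∈ J
    ∨-closed x∈J y∈J with directed x∈J y∈J
    ... | z , z∈J , x≤z , y≤z = downward (∨-least x≤z y≤z) z∈J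

    -- The family to which Zorn's lemma is applied; it starts from the principal filter of `v`.
    record Separates (F : Subset) : Set (c ⊔ ℓ₂ ⊔ p) where
      field
        isFilter : IsFilter ⟦ F ⟧
        contains : v ∈ ⟦ F ⟧
        avoids   : ∀ {x} → x ∈ ⟦ F ⟧ → x ∉ J
      open IsFilter isFilter public
    open Separates

    ↑v-separates : Separates ⟪ v ≤_ ⟫
    ↑v-separates = record
      { isFilter = record
        { upward = λ x≤y v≤x → ⟪⟫⁺ (v ≤_) (≤-trans (⟪⟫⁻ (v ≤_) v≤x) x≤y)
        ; meet   = λ v≤x v≤y →
            ⟪⟫⁺ (v ≤_) (∧-greatest (⟪⟫⁻ (v ≤_) v≤x) (⟪⟫⁻ (v ≤_) v≤y))
        }
      ; contains = ⟪⟫⁺ (v ≤_) ≤-refl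
      ; avoids   = λ v≤x x∈J → v∉J (downward (⟪⟫⁻ (v ≤_) v≤x) x∈J)
      }

    -- The chain hypothesis serves closure under meets: two elements of the union already lie in the
    -- larger of two members.
    ⋃-separates : (𝒞 : 𝒫 Subset) → Satisfiable 𝒞 → IsChain 𝒞 →
                  𝒞 ⊆ Separates → Separates (⋃ˢ 𝒞)
    ⋃-separates 𝒞 (_ , S∈𝒞) isChain separates = record
      { isFilter = record
        { upward = λ x≤y x∈⋃ → let S , S∈𝒞 , x∈S = ⋃ˢ⁻ 𝒞 x∈⋃ in
            ⋃ˢ-upper 𝒞 S∈𝒞 (upward (separates S∈𝒞) x≤y x∈S)
        ; meet   = ∧-closed
        }
      ; contains = ⋃ˢ-upper 𝒞 S∈𝒞 (contains (separates S∈𝒞))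
      ; avoids   = λ x∈⋃ → let S , S∈𝒞 , x∈S = ⋃ˢ⁻ 𝒞 x∈⋃ in
          avoids (separates S∈𝒞) x∈S
      }
      where
      ∧-closed : ∀ {x y} → x ∈ ⟦ ⋃ˢ 𝒞 ⟧ → y ∈ ⟦ ⋃ˢ 𝒞 ⟧ → (x ∧ y) ∈ ⟦ ⋃ˢ 𝒞 ⟧
      ∧-closed x∈⋃ y∈⋃ with ⋃ˢ⁻ 𝒞 x∈⋃ | ⋃ˢ⁻ 𝒞 y∈⋃
      ... | S , S∈𝒞 , x∈S | N , N∈𝒞 , y∈N with isChain S∈𝒞 N∈𝒞
      ...   | inj₁ S⊑N = ⋃ˢ-upper 𝒞 N∈𝒞 (meet (separates N∈𝒞) (S⊑N x∈S) y∈N)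
      ...   | inj₂ N⊑S = ⋃ˢ-upper 𝒞 S∈𝒞 (meet (separates S∈𝒞) x∈S (N⊑S y∈N))

    -- `Above` is the filter generated by `F` together with `x`.
    module Adjoin {F : Subset} (F-separates : Separates F) (x : Carrier) where
      Above : Pred Carrier _
      Above y = ∃ λ m → m ∈ ⟦ F ⟧ × m ∧ x ≤ y

      F⊑Above : F ⊑ ⟪ Above ⟫
      F⊑Above m∈F = ⟪⟫⁺ Above (_ , m∈F , x∧y≤x _ _)

      x∈Above : x ∈ ⟦ ⟪ Above ⟫ ⟧
      x∈Above = ⟪⟫⁺ Above (v , contains F-separates , x∧y≤y _ _)

      Above-separates : (∀ {m} → m ∈ ⟦ F ⟧ → (m ∧ x) ∉ J) → Separates ⟪ Above ⟫
      Above-separates misses = record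
        { isFilter = record
          { upward = λ y≤z y∈ → let m , m∈F , m∧x≤y = ⟪⟫⁻ Above y∈ in
              ⟪⟫⁺ Above (m , m∈F , ≤-trans m∧x≤y y≤z)
          ; meet   = λ y∈ z∈ →
              let m , m∈F , m∧x≤y = ⟪⟫⁻ Above y∈
                  n , n∈F , n∧x≤z = ⟪⟫⁻ Above z∈
              in ⟪⟫⁺ Above (m ∧ n , meet F-separates m∈F n∈F , ∧-greatest
                   (≤-trans (∧-monotonic (x∧y≤x _ _) ≤-refl) m∧x≤y)
                   (≤-trans (∧-monotonic (x∧y≤y _ _) ≤-refl) n∧x≤z))
          }
        ; contains = F⊑Above (contains F-separates)
        ; avoids   = λ y∈ y∈J → let m , m∈F , m∧x≤y = ⟪⟫⁻ Above y∈ in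
            misses m∈F (downward m∧x≤y y∈J)
        }

    open Zorn Separates ⋃-separates ↑v-separates using (zorn)

    primeFilter : ∃ λ M → Separates M × IsPrime ⟦ M ⟧
    primeFilter with zorn
    ... | M , M-separates , maximal = M , M-separates , prime
      where
      -- If the filter generated by `M` and `x` misses `J`, maximality puts it inside `M`, and `x`
      -- with it.
      dichotomy : ∀ x → x ∈ ⟦ M ⟧ ⊎ (∃ λ m → m ∈ ⟦ M ⟧ × (m ∧ x) ∈ J)
      dichotomy x with em {P = ∃ λ m → m ∈ ⟦ M ⟧ × (m ∧ x) ∈ J}
      ... | yes hit  = inj₂ hit
      ... | no  miss = inj₁
        (maximal (Above-separates λ m∈M m∧x∈J → miss (_ , m∈M , m∧x∈J))
                 F⊑Above x∈Above)
        where open Adjoin M-separates x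

      prime : IsPrime ⟦ M ⟧
      prime {x} {y} x∨y∈M with dichotomy x | dichotomy y
      ... | inj₁ x∈M | _        = inj₁ x∈M
      ... | inj₂ _   | inj₁ y∈M = inj₂ y∈M
      -- Distributivity puts `(m ∧ n) ∧ (x ∨ y)`, an element of `M`, below a join of two elements of
      -- `J`.
      ... | inj₂ (m , m∈M , m∧x∈J) | inj₂ (n , n∈M , n∧y∈J) = contradiction
        (downward below (∨-closed m∧x∈J n∧y∈J))
        (avoids M-separates
          (meet M-separates (meet M-separates m∈M n∈M) x∨y∈M))
        where
        below : (m ∧ n) ∧ (x ∨ y) ≤ (m ∧ x) ∨ (n ∧ y)
        below = ≤-trans (reflexive (∧-distribˡ-∨ (m ∧ n) x y))
          (∨-monotonic (∧-monotonic (x∧y≤x _ _) ≤-refl)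
                       (∧-monotonic (x∧y≤y _ _) ≤-refl))

-- Points of the spectral compactification from prime filters of the base.

module _ (em : ∀ {ℓ} → ExcludedMiddle ℓ)
         (ext : ∀ {a b} → Extensionality a b) where

  module _ (𝕏 : Space c ℓ t) (Ω₀ : Pred (𝒫 (Space.Carrier 𝕏)) o)
           (viable : IsViableBase 𝕏 Ω₀) where
    open Space 𝕏 using (Open; ⋃-open)
      renaming (Carrier to X; _≈_ to _≈ˣ_)
    open IsViableBase viable
    open Spectral em 𝕏 Ω₀ viable
    private
      module Ω = Poset Ω
      module L = Poset L
      module X̂ = Space X̂

    Ω-distributiveLattice : DistributiveLattice _ _ _
    Ω-distributiveLattice = record
      { Carrier = Ω.Carrier
      ; _≈_     = Ω._≈_
      ; _≤_     = Ω._≤_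
      ; _∨_     = λ (V , v) (W , w) → V ∪ W , ∪-mem v w
      ; _∧_     = λ (V , v) (W , w) → V ∩ W , ∩-mem v w
      ; isDistributiveLattice = record
        { isLattice = record
          { isPartialOrder = Ω.isPartialOrder
          ; supremum = λ _ _ → inj₁ , inj₂ , λ _ V⊆U W⊆U →
              λ { (inj₁ i) → V⊆U i ; (inj₂ j) → W⊆U j }
          ; infimum  = λ _ _ → proj₁ , proj₂ , λ _ U⊆V U⊆W i → U⊆V i , U⊆W i
          }
        ; ∧-distribˡ-∨ = λ _ _ _ →
            (λ { (i , inj₁ j) → inj₁ (i , j) ; (i , inj₂ k) → inj₂ (i , k) }) ,
            (λ { (inj₁ (i , j)) → i , inj₁ j ; (inj₂ (i , k)) → i , inj₂ k })
        }
      }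

    open PrimeFilterTheorem em ext Ω-distributiveLattice
    open Subsets em ext Ω.Carrier using (⟦_⟧)
    open DistributiveLattice Ω-distributiveLattice using (_∧_)

    Meeting : Pred Ω.Carrier p → Pred (Ideal Ω) _
    Meeting F I = proj₁ I ≬ F

    module _ {F : Pred Ω.Carrier p} (isFilter : IsFilter F) (isPrime : IsPrime F)
             (nonempty : Satisfiable F) (∅∉F : (∅ , ∅-mem) ∉ F) where
      open IsFilter isFilter

      private
        small : Meeting F ⊆ resize em (Meeting F)
        small {I} = proj₂ (resize-≐ em (Meeting F)) {I}
        large : resize em (Meeting F) ⊆ Meeting F
        large {I} = proj₁ (resize-≐ em (Meeting F)) {I}

      -- Closure under meets comes from `F` being a filter, complete primeness from the complement
      -- of `F` being an ideal.
      meeting-isCompletelyPrime : IsCompletelyPrimeFilter L (resize em (Meeting F))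
      meeting-isCompletelyPrime = record
        { nonempty = ⊤ᴵ , small {⊤ᴵ} (proj₁ nonempty , _ , proj₂ nonempty)
        ; upward   = λ {I} {J} I≤J I∈ →
            let u , u∈I , u∈F = large {I} I∈ in small {J} (u , I≤J {u} u∈I , u∈F)
        ; meet     = λ {I} {J} {M} → ∧-closed {I} {J} {M}
        ; prime    = prime
        }
        where
        ∧-closed : ∀ {I J M} → IsMeet L I J M → I ∈ resize em (Meeting F) →
                   J ∈ resize em (Meeting F) → M ∈ resize em (Meeting F)
        ∧-closed {I} {J} {M} isMeet I∈ J∈ =
          let u , u∈I , u∈F = large {I} I∈
              v , v∈J , v∈F = large {J} J∈
              -- `M` is known only by its universal property, so `w` enters it through `↓ w`, a
              -- lower bound of `I` and `J`.
              w = u ∧ v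
              w≤I = ↓-least {w} I (IsIdeal.downward (proj₂ I) {w} {u} proj₁ u∈I)
              w≤J = ↓-least {w} J (IsIdeal.downward (proj₂ J) {w} {v} proj₂ v∈J)
          in small {M} (w , greatest {↓ w} w≤I w≤J (lift id) , meet {u} {v} u∈F v∈F)
          where open IsMeet isMeet

        prime : ∀ {𝒜 : 𝒫 (Ideal Ω)} {J} → IsJoin L 𝒜 J →
                J ∈ resize em (Meeting F) → 𝒜 ≬ resize em (Meeting F)
        prime {𝒜} {J} isJoin J∈ with em {P = 𝒜 ≬ resize em (Meeting F)}
        ... | yes meets = meets
        ... | no misses =
          let u , u∈J , u∈F = large {J} J∈
          in contradiction u∈F (lower∉ (IsJoin.least isJoin {K} bound {u} u∈J))
          where
          lift∉ : (_∉ F) ⊆ resize em (_∉ F)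
          lift∉ = proj₂ (resize-≐ em (_∉ F))
          lower∉ : resize em (_∉ F) ⊆ (_∉ F)
          lower∉ = proj₁ (resize-≐ em (_∉ F))
          -- The complement of `F`. If no member of `𝒜` meets `F`, then `K` bounds `𝒜` and so
          -- contains `J`, although `u` lies in both `J` and `F`.
          K : Ideal Ω
          K = ideal (resize em (_∉ F))
            (λ {v} {w} v≤w w∉F → lift∉ (λ v∈F → lower∉ w∉F (upward {v} {w} v≤w v∈F)))
            (lift∉ ∅∉F)
            (λ {V} {W} v w p q → lift∉ (λ v∨w∈F →
               case isPrime {V , v} {W , w} v∨w∈F of
                 λ { (inj₁ v∈F) → lower∉ p v∈F ; (inj₂ w∈F) → lower∉ q w∈F }))
          bound : ∀ {I} → I ∈ 𝒜 → I L.≤ K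
          bound {I} I∈𝒜 {v} v∈I =
            lift∉ (λ v∈F → misses (I , I∈𝒜 , small {I} (v , v∈I , v∈F)))

    -- For `v` in `I` but not in `J`, a prime filter containing `v` and avoiding `J` gives a point
    -- of `𝒪 I` outside `𝒪 J`.
    𝒪-reflects-≤ : ∀ I J → 𝒪 I ⊆ 𝒪 J → I L.≤ J
    𝒪-reflects-≤ I J 𝒪I⊆𝒪J {v} v∈I with em {P = v ∈ proj₁ J}
    ... | yes v∈J = v∈J
    ... | no  v∉J with primeFilter (proj₂ J) {v} v∉J
    ...   | M , separates , isPrime = ⊥-elim (J-misses (𝒪I⊆𝒪J {y} I∈y))
      where
      open Separates separates
      y : CompletelyPrimeFilter L
      y = _ , meeting-isCompletelyPrime isFilter (λ {u} {w} → isPrime {u} {w})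
                (v , contains) (λ ∅∈M → avoids ∅∈M (∅∈ J))
      I∈y : I ∈ proj₁ y
      I∈y = proj₂ (resize-≐ em (Meeting ⟦ M ⟧)) {I} (v , v∈I , contains)
      J-misses : J ∉ proj₁ y
      J-misses J∈y = let u , u∈J , u∈M = proj₁ (resize-≐ em (Meeting ⟦ M ⟧)) {J} J∈y
                     in avoids u∈M u∈J

    -- Core-compactness.

    Opens : Poset _ _ _
    Opens = ⟨ X̂.Open ,⊆⟩
    private module Opens = Poset Opens

    -- The `Lift` raises `𝒪 I` to the universe of the points, where the subsets forming `Opens` take
    -- their values.
    𝒪̂ : Ideal Ω → Opens.Carrier
    𝒪̂ I = (λ y → Lift _ (𝒪 I y)) , I , lower , lift

    opens-complete : (𝒜 : 𝒫 Opens.Carrier) → ∃ (IsJoin Opens 𝒜)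
    opens-complete 𝒜 =
      let V , V-open , V⊆⋃ , ⋃⊆V = X̂.⋃-open {λ V → ∃ λ V-open → (V , V-open) ∈ 𝒜} proj₁
      in (V , V-open) , record
        { upper = λ {W} W∈𝒜 {y} y∈W → ⋃⊆V {y} ((proj₁ W , proj₂ W , W∈𝒜) , y∈W)
        ; least = λ {U} bound {y} y∈V →
            let (W , W-open , W∈𝒜) , y∈W = V⊆⋃ {y} y∈V in bound {W , W-open} W∈𝒜 {y} y∈W
        }

    -- The ideals of a directed family of opens are themselves directed by
    -- 𝒪-reflects-≤, so their union is already an ideal.
    ↓-compact : ∀ {v} {U : Opens.Carrier} → v ∈ proj₁ (proj₁ (proj₂ U)) →
                _≪_ Opens (𝒪̂ (↓ v)) U
    ↓-compact {v} {U , I , U⊆I , I⊆U} v∈I {D} D-directed {s} isJoin U≤s =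
      let d , d∈D , v∈d = large (𝒪-reflects-≤ I K (λ {y} → 𝒪I⊆𝒪K {y}) {v} v∈I)
      in d , d∈D , λ {y} v∈y → proj₂ (proj₂ (proj₂ d))
           (IsCompletelyPrimeFilter.upward (proj₂ y) {↓ v} {idealOf d}
             (↓-least {v} (idealOf d) v∈d) (lower v∈y))
      where
      open IsDirected D-directed
      idealOf : Opens.Carrier → Ideal Ω
      idealOf = proj₁ ∘ proj₂

      InSome : Pred Ω.Carrier _
      InSome w = ∃ λ d → d ∈ D × w ∈ proj₁ (idealOf d)
      large : resize em InSome ⊆ InSome
      large = proj₁ (resize-≐ em InSome)
      small : InSome ⊆ resize em InSome
      small = proj₂ (resize-≐ em InSome)

      idealOf-monotone : ∀ {d e} → d Opens.≤ e → idealOf d L.≤ idealOf e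
      idealOf-monotone {_ , J , _ , J⊆d} {_ , J′ , e⊆J′ , _} d≤e =
        𝒪-reflects-≤ J J′ (λ {y} y∈J → e⊆J′ (d≤e (J⊆d {y} y∈J)))

      K : Ideal Ω
      K = ideal (resize em InSome)
        (λ {w} {u} w≤u u∈K → let d , d∈D , u∈d = large u∈K in
           small (d , d∈D , IsIdeal.downward (proj₂ (idealOf d)) {w} {u} w≤u u∈d))
        (small (_ , proj₂ nonempty , ∅∈ (idealOf (proj₁ nonempty))))
        (λ {W} {W′} w w′ p q →
           let d , d∈D , w∈d  = large p
               e , e∈D , w′∈e = large q
               f , f∈D , d≤f , e≤f = directed d∈D e∈D
           in small (f , f∈D , ∪∈ (idealOf f) w w′
                (idealOf-monotone {d} {f} d≤f {W , w} w∈d)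
                (idealOf-monotone {e} {f} e≤f {W′ , w′} w′∈e)))

      bound : ∀ {d} → d ∈ D → d Opens.≤ 𝒪̂ K
      bound {d} d∈D {y} y∈d = lift
        (IsCompletelyPrimeFilter.upward (proj₂ y) {idealOf d} {K}
          (λ w∈d → small (d , d∈D , w∈d)) (proj₁ (proj₂ (proj₂ d)) y∈d))

      -- `𝒪̂ K` is an upper bound of `D`, hence lies above the join `s`, which lies above `U`.
      𝒪I⊆𝒪K : 𝒪 I ⊆ 𝒪 K
      𝒪I⊆𝒪K {y} y∈I =
        lower (IsJoin.least isJoin {𝒪̂ K} (λ {d} → bound {d}) (U≤s (I⊆U {y} y∈I)))

    PrincipalsIn : Ideal Ω → 𝒫 (Ideal Ω)
    PrincipalsIn I J = Lift (suc (suc c ⊔ o)) (∃ λ v → v ∈ proj₁ I × J ≡ ↓ v)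

    -- An upper bound of the principal ideals contains each `v` of `I`, because `v` belongs to
    -- `↓ v`.
    ↓-join : ∀ I → IsJoin L (PrincipalsIn I) I
    ↓-join I = record
      { upper = λ { (lift (v , v∈I , refl)) → ↓-least {v} I v∈I }
      ; least = λ bound {v} v∈I → bound (lift (v , v∈I , refl)) (lift id)
      }

    -- The test family is all opens inside `V`: it is directed, with `V` as greatest element and
    -- join.
    ≪⇒≤ : ∀ {U V} → _≪_ Opens U V → U Opens.≤ V
    ≪⇒≤ {U} {V} U≪V {y} y∈U =
      let W , W≤V , U≤W = U≪V {Below} directed {V} isJoin id
      in lower W≤V (U≤W y∈U)
      where
      Below : 𝒫 Opens.Carrier
      Below W = Lift _ (W Opens.≤ V)
      directed : IsDirected Opens Below
      directed = record
        { nonempty = V , lift id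
        ; directed = λ p q → V , lift id , (λ i → lower p i) , (λ i → lower q i)
        }
      isJoin : IsJoin Opens Below V
      isJoin = record { upper = λ p i → lower p i ; least = λ bound {y} → bound {V} (lift id) {y} }

    X̂-coreCompact : CoreCompact X̂
    X̂-coreCompact = record
      { complete      = opens-complete
      ; approximation = λ U → record
        { upper = λ {V} → ≪⇒≤ {V} {U}
        ; least = λ {W} → ≤-bound U {W}
        }
      }
      where
      ≤-bound : ∀ U {W} → (∀ {V} → _≪_ Opens V U → V Opens.≤ W) → U Opens.≤ W
      -- The point `y` contains `I`, a join of principal ideals, so complete primeness puts some
      -- `↓ v` with `v` in `I` into `y`. Its open is way below `U`, hence inside `W`.
      ≤-bound U@(_ , I , U⊆I , _) bound {y} y∈U
        with IsCompletelyPrimeFilter.prime (proj₂ y) {PrincipalsIn I} (↓-join I) (U⊆I y∈U)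
      ... | _ , lift (v , v∈I , refl) , v∈y =
        bound {𝒪̂ (↓ v)} (↓-compact {v} {U} v∈I) (lift v∈y)

    -- The topological embedding.

    ι-embedding : T₀ 𝕏 → IsEmbedding 𝕏 X̂ ι
    ι-embedding t₀ = record
      { continuous      = continuous
      ; injective       = injective
      ; relatively-open = relatively-open
      }
      where
      continuous : ∀ {W} → X̂.Open W → ∃ λ V → Open V × V ≐ (Func.to ι ⊢ W)
      continuous {W} (I , W⊆I , I⊆W) =
        -- The preimage of `𝒪 I` under `ι` is the union of the members of `I`.
        let V , V-open , V⊆⋃ , ⋃⊆V = ⋃-open {resize em InI} λ p → ⊆Open (proj₁ (large p))
        in V , V-open
         , (λ x∈V → let (U , U∈) , x∈U = V⊆⋃ x∈V in
              I⊆W (lift ((_ , proj₂ (large U∈)) , x∈U)))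
         , (λ x∈W → let ((U , u) , u∈I) , x∈U = lower (W⊆I x∈W) in
              ⋃⊆V ((U , small (u , u∈I)) , x∈U))
        where
        InI : Pred (𝒫 X) _
        InI U = ∃ λ u → (U , u) ∈ proj₁ I
        large : resize em InI ⊆ InI
        large = proj₁ (resize-≐ em InI)
        small : InI ⊆ resize em InI
        small = proj₂ (resize-≐ em InI)

      -- A base set `B` with `x` in `B` and `B` inside `V` puts `↓ b` into `ι₀ x`, hence into
      -- `ι₀ y`. Then `y` lies in a subset of `B`.
      transfer : ∀ {x y V} → ι₀ x ⊆ ι₀ y → Open V → x ∈ V → y ∈ V
      transfer ιx⊆ιy V-open x∈V =
        let ℬ , ℬ⊆Ω₀ , V⊆⋃ , ⋃⊆V = isBase V-open
            (B , B∈ℬ) , x∈B = V⊆⋃ x∈V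
            b = B , ℬ⊆Ω₀ B∈ℬ
            (u , u≤b) , y∈u = lower (ιx⊆ιy {↓ b} (lift ((b , lift id) , x∈B)))
        in ⋃⊆V ((B , B∈ℬ) , lower u≤b y∈u)

      injective : Injective _≈ˣ_ X̂._≈_ (Func.to ι)
      injective {x} {y} (ιx⊆ιy , ιy⊆ιx) with em {P = x ≈ˣ y}
      ... | yes x≈y = x≈y
      ... | no  x≉y with t₀ x≉y
      ...   | V , V-open , inj₁ (x∈V , y∉V) =
        contradiction (transfer (λ {I} → ιx⊆ιy {I}) V-open x∈V) y∉V
      ...   | V , V-open , inj₂ (x∉V , y∈V) =
        contradiction (transfer (λ {I} → ιy⊆ιx {I}) V-open y∈V) x∉V

      relatively-open : ∀ {V} → Open V →
        ∃ λ W → X̂.Open W × image 𝕏 X̂ ι V ≐ W ∩ range 𝕏 X̂ ι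
      relatively-open {V} V-open = proj₁ (𝒪̂ I) , proj₂ (𝒪̂ I)
        , (λ (x , x∈V , ιx⊆y , y⊆ιx) →
             lift (ιx⊆y {I} (∈ι x∈V)) , x , (λ {J} → ιx⊆y {J}) , (λ {J} → y⊆ιx {J}))
        , (λ (lift I∈y , x , ιx⊆y , y⊆ιx) →
             let (_ , u⊆V) , x∈u = lower (y⊆ιx {I} I∈y)
             in x , lower u⊆V x∈u , (λ {J} → ιx⊆y {J}) , (λ {J} → y⊆ιx {J}))
        where
        -- The ideal of base sets inside `V`. Its union is `V` because `Ω₀` is a base, so `𝒪 I` cuts
        -- the image of `V` out of the range.
        I : Ideal Ω
        I = ideal (λ u → Lift _ (proj₁ u ⊆ V))
          (λ v≤w w⊆V → lift λ i → lower w⊆V (v≤w i))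
          (lift λ ())
          (λ _ _ p q → lift λ { (inj₁ i) → lower p i ; (inj₂ j) → lower q j })

        ∈ι : ∀ {x} → x ∈ V → I ∈ ι₀ x
        ∈ι x∈V =
          let ℬ , ℬ⊆Ω₀ , V⊆⋃ , ⋃⊆V = isBase V-open
              (B , B∈ℬ) , x∈B = V⊆⋃ x∈V
          in lift (((B , ℬ⊆Ω₀ B∈ℬ) , lift λ i → ⋃⊆V ((B , B∈ℬ) , i)) , x∈B)

    -- Density.

    -- Every member of such an `I` has no points, so it lies below the empty base set, which belongs
    -- to every ideal.
    unpointed-isBottom : ∀ I → ¬ Satisfiable (⋃ᴵ I) → IsJoin L {p = p} ∅ I
    unpointed-isBottom I unpointed = record
      { upper = λ ()
      ; least = λ {J} _ {u} u∈I → IsIdeal.downward (proj₂ J) {u} {∅ , ∅-mem}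
          (λ i → ⊥-elim (unpointed (_ , (u , u∈I) , i))) (∅∈ J)
      }

    -- A point `x` of `⋃ᴵ I` has its image in `W`. Without such a point, `y` would contain an empty
    -- join, and complete primeness would produce an element of the empty family.
    ι-dense : Dense 𝕏 X̂ ι
    ι-dense {W} (I , W⊆I , I⊆W) (y , y∈W) with em {P = Satisfiable (⋃ᴵ I)}
    ... | yes (x , x∈I) = Func.to ι x , I⊆W (lift x∈I) , x , X̂.refl {Func.to ι x}
    ... | no unpointed
      with IsCompletelyPrimeFilter.prime (proj₂ y) {∅} (unpointed-isBottom I unpointed)
             (W⊆I y∈W)
    ...   | _ , () , _

    ι-isCoreCompactification : T₀ 𝕏 → IsCoreCompactification 𝕏 X̂ ι
    ι-isCoreCompactification t₀ = record
      { core-compact = X̂-coreCompact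
      ; embedding    = ι-embedding t₀
      ; dense        = ι-dense
      }

  -- The theorem is proved with em fixed as a module parameter: applying a lemma
  -- to em instead makes Agda compare two η-variants of em by unfolding X̂.
  X̂-isCoreCompactification : ∀ {c ℓ t o} (𝕏 : Space c ℓ t) → T₀ 𝕏 →
    (Ω₀ : Pred (𝒫 (Space.Carrier 𝕏)) o) (viable : IsViableBase 𝕏 Ω₀) →
    IsCoreCompactification 𝕏 (Spectral.X̂ em 𝕏 Ω₀ viable) (Spectral.ι em 𝕏 Ω₀ viable)
  X̂-isCoreCompactification 𝕏 t₀ Ω₀ viable = ι-isCoreCompactification 𝕏 Ω₀ viable t₀

mainTheorem15 : (em : ∀ {ℓ} → ExcludedMiddle ℓ) →
    (ext : ∀ {a b} → Extensionality a b) →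
    ∀ {c ℓ t o} (𝕏 : Space c ℓ t) → T₀ 𝕏 →
    (Ω₀ : Pred (𝒫 (Space.Carrier 𝕏)) o) (viable : IsViableBase 𝕏 Ω₀) →
    IsCoreCompactification 𝕏 (Spectral.X̂ em 𝕏 Ω₀ viable) (Spectral.ι em 𝕏 Ω₀ viable)
mainTheorem15 = X̂-isCoreCompactification
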